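{- Let $k\ge 0$ be an integer and let $G$ be a graph of order $n=4k+1$ with Seidel matrix $S$. Then $S$ is singular and $\phi(S)\in\{\pm 1\}^n$ if and only if $G$ belongs to the switching class of a $2k$-regular graph.
   Context: All graphs are simple, undirected, finite, with at least one vertex. The order of a graph is its number of vertices. For a graph $G$ with vertices $v_1,\dots,v_n$ and adjacency matrix $A$, the Seidel matrix of $G$ is $S=J_n-I_n-2A$, where $J_n$ is the all-ones $n\times n$ matrix and $I_n$ the identity. It is known that $\operatorname{rank} S\ge n-1$ always. Hence, when $S$ is singular, its nullspace is one-dimensional, and $\phi(S)$ denotes the unique integer vector $\phi\in\mathbb{Z}^n$ with $S\phi=0$, with the greatest common divisor of its entries equal to $1$, and with first non-zero entry positive. Switching a graph with respect to a vertex $v$ means deleting all edges between $v$ and its neighbors and making $v$ adjacent to all its former non-neighbors (other than $v$ itself). Two graphs on the same vertex set are switching-equivalent if one can be obtained from the other by a sequence of switchings; equivalently, if one is obtained from the other by choosing a vertex subset $A$ and complementing the edges and non-edges between $A$ and its complement. The switching class of a graph is its equivalence class under this relation. -}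

module Defs where

open import Algebra.Bundles using (Semiring; CommutativeRing)
open import Data.Bool.Base using (Bool; false; _xor_; if_then_else_)
open import Data.Bool.Properties using (xor-same; xor-comm)
open import Data.Fin.Base using (Fin; _<_)
open import Data.Fin.Properties using (_≟_)
open import Data.Fin.Subset using (Subset; ∣_∣)
open import Data.Integer.Base as ℤ using (ℤ; +_; 0ℤ; 1ℤ; -1ℤ)
open import Data.Integer.GCD using (gcd)
import Data.Integer.Properties as ℤₚ
open import Data.List.Base using (List; foldl)
open import Data.Nat.Base using (ℕ)
open import Data.Product.Base using (_×_; ∃)
open import Data.Rational.Base as ℚ using ()
import Data.Rational.Properties as ℚₚ
open import Data.Sum.Base using (_⊎_)
open import Data.Vec.Base using (tabulate)
open import Data.Vec.Functional using (Vector; foldr)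
open import Relation.Binary.PropositionalEquality
  using (_≡_; _≗_; trans; cong; cong₂)
open import Level using (_⊔_)
open import Relation.Nullary using (¬_)
open import Relation.Nullary.Decidable.Core using (does)

record Graph (n : ℕ) : Set where
  field
    adj     : Fin n → Fin n → Bool
    adj-sym : ∀ i j → adj i j ≡ adj j i
    no-loop : ∀ i → adj i i ≡ false

open Graph public

infix 4 _≐_

-- Pointwise, since function extensionality is not available.
_≐_ : ∀ {n} → Graph n → Graph n → Set
G ≐ H = ∀ i j → adj G i j ≡ adj H i j

neighbours : ∀ {n} → Graph n → Fin n → Subset n
neighbours G v = tabulate (adj G v)

degree : ∀ {n} → Graph n → Fin n → ℕ
degree G v = ∣ neighbours G v ∣

Regular : ∀ {n} → ℕ → Graph n → Set
Regular d G = ∀ v → degree G v ≡ d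

-- Adjacency of i and j is toggled when exactly one of i and j is v; in
-- particular the diagonal is left alone.
switch : ∀ {n} → Graph n → Fin n → Graph n
switch G v = record
  { adj     = λ i j → (does (i ≟ v) xor does (j ≟ v)) xor adj G i j
  ; adj-sym = λ i j → cong₂ _xor_ (xor-comm (does (i ≟ v)) (does (j ≟ v))) (adj-sym G i j)
  ; no-loop = λ i → trans (cong (_xor adj G i i) (xor-same (does (i ≟ v)))) (no-loop G i)
  }

SwitchingEquivalent : ∀ {n} → Graph n → Graph n → Set
SwitchingEquivalent {n} G H = ∃ λ (vs : List (Fin n)) → foldl switch G vs ≐ H

Matrix : ∀ {a} → Set a → ℕ → Set a
Matrix A n = Fin n → Fin n → A

module MatrixOps {c ℓ} (R : Semiring c ℓ) where
  open Semiring R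
  open import Algebra.Properties.Semiring.Sum R using (sum)

  infixl 7 _*ₘ_ _*ᵥ_

  𝟙 : ∀ {n} → Matrix Carrier n
  𝟙 i j = if does (i ≟ j) then 1# else 0#

  _*ₘ_ : ∀ {n} → Matrix Carrier n → Matrix Carrier n → Matrix Carrier n
  (M *ₘ N) i j = sum λ k → M i k * N k j

  _*ᵥ_ : ∀ {n} → Matrix Carrier n → Vector Carrier n → Vector Carrier n
  (M *ᵥ x) i = sum λ j → M i j * x j

  Invertible : ∀ {n} → Matrix Carrier n → Set (c ⊔ ℓ)
  Invertible {n} M = ∃ λ (N : Matrix Carrier n) →
    (∀ i j → (M *ₘ N) i j ≈ 𝟙 i j) × (∀ i j → (N *ₘ M) i j ≈ 𝟙 i j)

module ℤ-Mat = MatrixOps (CommutativeRing.semiring ℤₚ.+-*-commutativeRing)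
module ℚ-Mat = MatrixOps (CommutativeRing.semiring ℚₚ.+-*-commutativeRing)

-- Singularity is not being invertible over the field ℚ: over ℤ that would
-- say that the determinant is not a unit.
Singular : ∀ {n} → Matrix ℤ n → Set
Singular M = ¬ ℚ-Mat.Invertible (λ i j → M i j ℚ./ 1)

adjacency : ∀ {n} → Graph n → Matrix ℤ n
adjacency G i j = if adj G i j then 1ℤ else 0ℤ

allOnes : ∀ {n} → Matrix ℤ n
allOnes i j = 1ℤ

seidel : ∀ {n} → Graph n → Matrix ℤ n
seidel G i j = allOnes i j ℤ.- ℤ-Mat.𝟙 i j ℤ.- + 2 ℤ.* adjacency G i j

FirstNonZeroPositive : ∀ {n} → Vector ℤ n → Set
FirstNonZeroPositive x = ∃ λ i → 0ℤ ℤ.< x i × (∀ j → j < i → x j ≡ 0ℤ)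

record IsNormalisedNullVector {n} (M : Matrix ℤ n) (x : Vector ℤ n) : Set where
  field
    null                 : ∀ i → (M ℤ-Mat.*ᵥ x) i ≡ 0ℤ
    gcd≡1                : foldr gcd 0ℤ x ≡ 1ℤ
    firstNonZeroPositive : FirstNonZeroPositive x

-- IsPhi S φ says that φ(S) is defined and equal to φ. Uniqueness is part of
-- the definition, so φ(S) is a definite description for any matrix S.
record IsPhi {n} (S : Matrix ℤ n) (φ : Vector ℤ n) : Set where
  field
    normalisedNullVector : IsNormalisedNullVector S φ
    unique               : ∀ ψ → IsNormalisedNullVector S ψ → ψ ≗ φ

SignVector : ∀ {n} → Vector ℤ n → Set
SignVector x = ∀ i → x i ≡ 1ℤ ⊎ x i ≡ -1ℤ

{-# OPTIONS --safe #-}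

-- Switching G at a vertex set with sign vector s turns S into D S D, where
-- D = diag s. Hence s is a null vector of S exactly when the all-ones vector is
-- one of the switched graph H, and row i of the latter says n - 1 = 2 deg i.
-- Uniqueness of φ(S) is a descent: S ≡ J - I mod 2, so all entries of an
-- integer null vector have the same parity; if its first entry is 0, then all
-- entries are even, and half of it is again such a vector.
module Submission where

open import Defs
open import Algebra.Bundles using (Semiring; CommutativeRing)
open import Data.Bool.Base using (Bool; true; false; not; _xor_; if_then_else_)
import Data.Bool.Properties as Bool
open import Data.Empty using (⊥-elim)
open import Data.Fin.Base using (Fin; zero; suc)
open import Data.Fin.Properties using (_≟_)
open import Data.Fin.Subset using (∣_∣)
open import Data.Integer.Base as ℤ using (ℤ; +_; 0ℤ; 1ℤ; -1ℤ)
open import Data.Integer.Divisibility using (_∣_)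
open import Data.Integer.GCD using (gcd; gcd-greatest; gcd-zeroˡ)
import Data.Integer.Properties as ℤₚ
open import Data.Integer.Tactic.RingSolver using (solve-∀)
open import Data.List.Base using (List; []; _∷_; foldl; map)
open import Data.Nat.Base as ℕ using (ℕ; zero; suc; _+_; _*_)
import Data.Nat.Divisibility as ℕ∣
import Data.Nat.Properties as ℕₚ
open import Data.Product.Base using (_×_; ∃; _,_; proj₁; proj₂)
import Data.Rational.Base as ℚ
import Data.Rational.Properties as ℚₚ
open import Data.Rational.Unnormalised.Base as ℚᵘ using (mkℚᵘ; *≡*)
import Data.Rational.Unnormalised.Properties as ℚᵘₚ
open import Data.Sum.Base using (_⊎_; inj₁; inj₂)
open import Data.Vec.Base using (tabulate)
open import Data.Vec.Functional using (Vector; foldr)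
open import Function.Base using (_∘_)
open import Function.Bundles using (_⇔_; mk⇔)
open import Relation.Binary.PropositionalEquality
  using (_≡_; _≗_; refl; sym; trans; cong; cong₂; subst; module ≡-Reasoning)
open import Relation.Nullary.Decidable.Core using (Dec; yes; no; does)

-- Matrix algebra over a semiring.

module MatrixProperties {c ℓ} (R : Semiring c ℓ) where
  open Semiring R using (Carrier; _≈_; 0#; setoid; zeroˡ; zeroʳ; *-assoc;
    *-identityˡ; +-identityˡ; +-identityʳ; +-cong; *-congˡ; *-congʳ)
    renaming (_*_ to _⊛_; trans to ≈-trans)
  open import Algebra.Properties.Semiring.Sum R
  open MatrixOps R
  open import Relation.Binary.Reasoning.Setoid setoid

  sum-zero : ∀ {n} (x : Vector Carrier n) → (∀ i → x i ≈ 0#) → sum x ≈ 0#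
  sum-zero {n} x x≈0 = ≈-trans (sum-cong-≋ x≈0) (sum-replicate-zero n)

  𝟙-*ᵥ : ∀ {n} (x : Vector Carrier n) i → (𝟙 *ᵥ x) i ≈ x i
  𝟙-*ᵥ x zero    = ≈-trans
    (+-cong (*-identityˡ _) (sum-zero _ λ j → zeroˡ (x (suc j)))) (+-identityʳ _)
  𝟙-*ᵥ x (suc i) = ≈-trans (+-cong (zeroˡ _) (𝟙-*ᵥ (x ∘ suc) i)) (+-identityˡ _)

  *ₘ-*ᵥ-assoc : ∀ {n} (M N : Matrix Carrier n) x i →
                ((M *ₘ N) *ᵥ x) i ≈ (M *ᵥ (N *ᵥ x)) i
  *ₘ-*ᵥ-assoc M N x i = begin
    sum (λ j → sum (λ k → M i k ⊛ N k j) ⊛ x j)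
      ≈⟨ sum-cong-≋ (λ j → *-distribʳ-sum (x j) (λ k → M i k ⊛ N k j)) ⟩
    sum (λ j → sum (λ k → M i k ⊛ N k j ⊛ x j))
      ≈⟨ ∑-comm (λ j k → M i k ⊛ N k j ⊛ x j) ⟩
    sum (λ k → sum (λ j → M i k ⊛ N k j ⊛ x j))
      ≈⟨ sum-cong-≋ (λ k → sum-cong-≋ λ j → *-assoc (M i k) (N k j) (x j)) ⟩
    sum (λ k → sum (λ j → M i k ⊛ (N k j ⊛ x j)))
      ≈⟨ sum-cong-≋ (λ k → *-distribˡ-sum (M i k) (λ j → N k j ⊛ x j)) ⟨
    sum (λ k → M i k ⊛ sum (λ j → N k j ⊛ x j)) ∎

  -- With `N` the inverse, `x` = (`N` `M`) `x` = `N` (`M` `x`) = 0.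
  invertible⇒trivialKernel : ∀ {n} {M : Matrix Carrier n} → Invertible M → ∀ x →
                             (∀ i → (M *ᵥ x) i ≈ 0#) → ∀ i → x i ≈ 0#
  invertible⇒trivialKernel {M = M} (N , _ , NM≈𝟙) x Mx≈0 i = begin
    x i                   ≈⟨ 𝟙-*ᵥ x i ⟨
    (𝟙 *ᵥ x) i            ≈⟨ sum-cong-≋ (λ j → *-congʳ (NM≈𝟙 i j)) ⟨
    ((N *ₘ M) *ᵥ x) i     ≈⟨ *ₘ-*ᵥ-assoc N M x i ⟩
    (N *ᵥ (M *ᵥ x)) i     ≈⟨ sum-zero _ (λ j → ≈-trans (*-congˡ (Mx≈0 j)) (zeroʳ _)) ⟩
    0#                    ∎

open import Algebra.Properties.Semiring.Sum ℤₚ.+-*-semiring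
  using (sum; sum-cong-≗; ∑-distrib-+; *-distribˡ-sum)
open import Algebra.Properties.Semiring.Sum
  (CommutativeRing.semiring ℚₚ.+-*-commutativeRing)
  using () renaming (sum to sumℚ; sum-cong-≗ to sumℚ-cong)
open import Algebra.Properties.Group (CommutativeRing.+-group ℤₚ.+-*-commutativeRing) using (∙-cancelˡ; ∙-cancelʳ)
open ℤ-Mat using (𝟙; _*ᵥ_)
module ℤ-MatProperties = MatrixProperties ℤₚ.+-*-semiring
module ℚ-MatProperties =
  MatrixProperties (CommutativeRing.semiring ℚₚ.+-*-commutativeRing)

-- The embedding of the integers into the rationals.

/1-toℚᵘ : ∀ i → ℚ.toℚᵘ (i ℚ./ 1) ℚᵘ.≃ mkℚᵘ i 0
/1-toℚᵘ i = ℚₚ.toℚᵘ-fromℚᵘ (mkℚᵘ i 0)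

-- Reduction to lowest terms does not compute on a variable numerator; in the unnormalised rationals
-- only a ring identity is left.
/1-homo-+ : ∀ i j → (i ℤ.+ j) ℚ./ 1 ≡ (i ℚ./ 1) ℚ.+ (j ℚ./ 1)
/1-homo-+ i j = ℚₚ.toℚᵘ-injective (begin
  ℚ.toℚᵘ ((i ℤ.+ j) ℚ./ 1)                   ≈⟨ /1-toℚᵘ (i ℤ.+ j) ⟩
  mkℚᵘ (i ℤ.+ j) 0                           ≈⟨ *≡* (lemma i j) ⟩
  mkℚᵘ i 0 ℚᵘ.+ mkℚᵘ j 0                     ≈⟨ ℚᵘₚ.+-cong (/1-toℚᵘ i) (/1-toℚᵘ j) ⟨
  ℚ.toℚᵘ (i ℚ./ 1) ℚᵘ.+ ℚ.toℚᵘ (j ℚ./ 1)     ≈⟨ ℚₚ.toℚᵘ-homo-+ (i ℚ./ 1) (j ℚ./ 1) ⟨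
  ℚ.toℚᵘ ((i ℚ./ 1) ℚ.+ (j ℚ./ 1))           ∎)
  where
  open import Relation.Binary.Reasoning.Setoid ℚᵘₚ.≃-setoid
  lemma : ∀ i j → (i ℤ.+ j) ℤ.* 1ℤ ≡ (i ℤ.* 1ℤ ℤ.+ j ℤ.* 1ℤ) ℤ.* 1ℤ
  lemma = solve-∀

/1-homo-* : ∀ i j → (i ℤ.* j) ℚ./ 1 ≡ (i ℚ./ 1) ℚ.* (j ℚ./ 1)
/1-homo-* i j = ℚₚ.toℚᵘ-injective (begin
  ℚ.toℚᵘ ((i ℤ.* j) ℚ./ 1)                   ≈⟨ /1-toℚᵘ (i ℤ.* j) ⟩
  mkℚᵘ i 0 ℚᵘ.* mkℚᵘ j 0                     ≈⟨ ℚᵘₚ.*-cong (/1-toℚᵘ i) (/1-toℚᵘ j) ⟨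
  ℚ.toℚᵘ (i ℚ./ 1) ℚᵘ.* ℚ.toℚᵘ (j ℚ./ 1)     ≈⟨ ℚₚ.toℚᵘ-homo-* (i ℚ./ 1) (j ℚ./ 1) ⟨
  ℚ.toℚᵘ ((i ℚ./ 1) ℚ.* (j ℚ./ 1))           ∎)
  where open import Relation.Binary.Reasoning.Setoid ℚᵘₚ.≃-setoid

/1-homo-sum : ∀ {n} (x : Vector ℤ n) → sum x ℚ./ 1 ≡ sumℚ (λ i → x i ℚ./ 1)
/1-homo-sum {zero}  x = refl
/1-homo-sum {suc n} x = trans (/1-homo-+ (x zero) (sum (x ∘ suc)))
  (cong (ℚ._+_ (x zero ℚ./ 1)) (/1-homo-sum (x ∘ suc)))

-- Integer null vectors of matrices.

IsNull : ∀ {n} → Matrix ℤ n → Vector ℤ n → Set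
IsNull M x = ∀ i → (M *ᵥ x) i ≡ 0ℤ

-- A rational inverse would force every entry of `x` to be 0, but an entry 1 maps to a rational
-- visibly different from 0.
nullVector⇒singular : ∀ {n} {M : Matrix ℤ n} x → IsNull M x →
                      ∀ i → x i ≡ 1ℤ → Singular M
nullVector⇒singular {M = M} x Mx≡0 i xi≡1 inv with trans (sym (cong (ℚ._/ 1) xi≡1))
  (ℚ-MatProperties.invertible⇒trivialKernel inv (λ j → x j ℚ./ 1) null i)
  where
  null : ∀ k → ((λ i j → M i j ℚ./ 1) ℚ-Mat.*ᵥ (λ j → x j ℚ./ 1)) k ≡ ℚ.0ℚ
  null k = trans (sumℚ-cong λ j → sym (/1-homo-* (M k j) (x j)))
    (trans (sym (/1-homo-sum (λ j → M k j ℤ.* x j))) (cong (ℚ._/ 1) (Mx≡0 k)))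
... | ()

*ᵥ-scale : ∀ {n} (M : Matrix ℤ n) c x i →
           (M *ᵥ (λ j → c ℤ.* x j)) i ≡ c ℤ.* (M *ᵥ x) i
*ᵥ-scale M c x i = trans (sum-cong-≗ λ j → swap (M i j) c (x j))
  (sym (*-distribˡ-sum c (λ j → M i j ℤ.* x j)))
  where
  swap : ∀ m c x → m ℤ.* (c ℤ.* x) ≡ c ℤ.* (m ℤ.* x)
  swap = solve-∀

*ᵥ-distrib-+ : ∀ {n} (M : Matrix ℤ n) x y i →
               (M *ᵥ (λ j → x j ℤ.+ y j)) i ≡ (M *ᵥ x) i ℤ.+ (M *ᵥ y) i
*ᵥ-distrib-+ M x y i = trans (sum-cong-≗ λ j → ℤₚ.*-distribˡ-+ (M i j) (x j) (y j))
  (∑-distrib-+ (λ j → M i j ℤ.* x j) (λ j → M i j ℤ.* y j))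

-- (S + I + 2A) x = J x, arranged so that no subtraction occurs.
seidel-row : ∀ {n} (G : Graph n) x i →
  (seidel G *ᵥ x) i ℤ.+ (x i ℤ.+ + 2 ℤ.* (adjacency G *ᵥ x) i) ≡ sum x
seidel-row G x i = sym (begin
  sum x
    ≡⟨ sum-cong-≗ (λ j → split (𝟙 i j) (adjacency G i j) (x j)) ⟩
  sum (λ j → s j ℤ.+ (e j ℤ.+ + 2 ℤ.* a j))
    ≡⟨ ∑-distrib-+ s (λ j → e j ℤ.+ + 2 ℤ.* a j) ⟩
  sum s ℤ.+ sum (λ j → e j ℤ.+ + 2 ℤ.* a j)
    ≡⟨ cong (ℤ._+_ (sum s)) (∑-distrib-+ e (λ j → + 2 ℤ.* a j)) ⟩
  sum s ℤ.+ (sum e ℤ.+ sum (λ j → + 2 ℤ.* a j))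
    ≡⟨ cong (ℤ._+_ (sum s))
         (cong₂ ℤ._+_ (ℤ-MatProperties.𝟙-*ᵥ x i) (sym (*-distribˡ-sum (+ 2) a))) ⟩
  sum s ℤ.+ (x i ℤ.+ + 2 ℤ.* sum a) ∎)
  where
  open ≡-Reasoning
  s e a : Vector ℤ _
  s j = seidel G i j ℤ.* x j
  e j = 𝟙 i j ℤ.* x j
  a j = adjacency G i j ℤ.* x j
  split : ∀ d a x → x ≡ (1ℤ ℤ.- d ℤ.- + 2 ℤ.* a) ℤ.* x ℤ.+ (d ℤ.* x ℤ.+ + 2 ℤ.* (a ℤ.* x))
  split = solve-∀

-- The right-hand side does not depend on `i`, so all entries of `x` have the same parity.
null-row : ∀ {n} (G : Graph n) x → IsNull (seidel G) x →
           ∀ i → x i ℤ.+ + 2 ℤ.* (adjacency G *ᵥ x) i ≡ sum x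
null-row G x Sx≡0 i = trans (sym (ℤₚ.+-identityˡ _))
  (trans (cong (ℤ._+ (x i ℤ.+ + 2 ℤ.* (adjacency G *ᵥ x) i)) (sym (Sx≡0 i))) (seidel-row G x i))

-- Descent: the nullspace is at most one-dimensional.

null-half : ∀ {m} (G : Graph (suc m)) x → IsNull (seidel G) x → x zero ≡ 0ℤ →
            ∃ λ y → (∀ i → x i ≡ + 2 ℤ.* y i) × IsNull (seidel G) y × y zero ≡ 0ℤ
null-half G x Sx≡0 x₀≡0 = y , x≡2y , Sy≡0 , ℤₚ.+-inverseʳ (Ax zero)
  where
  open ≡-Reasoning
  Ax y : Vector ℤ _
  Ax  = adjacency G *ᵥ x
  -- Rows `zero` and `i` of `null-row` have equal right-hand sides and `x zero` is 0, so `x i` is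
  -- twice this difference. The half is thus explicit, with no division.
  y i = Ax zero ℤ.- Ax i

  cancel : ∀ u v → u ≡ u ℤ.+ + 2 ℤ.* v ℤ.- + 2 ℤ.* v
  cancel = solve-∀
  collect : ∀ u v → 0ℤ ℤ.+ + 2 ℤ.* u ℤ.- + 2 ℤ.* v ≡ + 2 ℤ.* (u ℤ.- v)
  collect = solve-∀

  x≡2y : ∀ i → x i ≡ + 2 ℤ.* y i
  x≡2y i = begin
    x i                                            ≡⟨ cancel (x i) (Ax i) ⟩
    x i ℤ.+ + 2 ℤ.* Ax i ℤ.- + 2 ℤ.* Ax i
      ≡⟨ cong (ℤ._- + 2 ℤ.* Ax i) (trans (null-row G x Sx≡0 i) (sym (null-row G x Sx≡0 zero))) ⟩
    x zero ℤ.+ + 2 ℤ.* Ax zero ℤ.- + 2 ℤ.* Ax i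
      ≡⟨ cong (λ t → t ℤ.+ + 2 ℤ.* Ax zero ℤ.- + 2 ℤ.* Ax i) x₀≡0 ⟩
    0ℤ ℤ.+ + 2 ℤ.* Ax zero ℤ.- + 2 ℤ.* Ax i        ≡⟨ collect (Ax zero) (Ax i) ⟩
    + 2 ℤ.* y i                                    ∎

  Sy≡0 : IsNull (seidel G) y
  Sy≡0 i = ℤₚ.*-cancelˡ-≡ (+ 2) ((seidel G *ᵥ y) i) 0ℤ (begin
    + 2 ℤ.* (seidel G *ᵥ y) i              ≡⟨ *ᵥ-scale (seidel G) (+ 2) y i ⟨
    (seidel G *ᵥ (λ j → + 2 ℤ.* y j)) i    ≡⟨ sum-cong-≗ (λ j → cong (seidel G i j ℤ.*_) (x≡2y j)) ⟨
    (seidel G *ᵥ x) i                      ≡⟨ Sx≡0 i ⟩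
    0ℤ                                     ∎)

2m≤1+n⇒m≤n : ∀ {m n} → 2 * m ℕ.≤ suc n → m ℕ.≤ n
2m≤1+n⇒m≤n {zero}  _               = ℕ.z≤n
2m≤1+n⇒m≤n {suc m} (ℕ.s≤s m+1+m≤n) =
  ℕₚ.≤-trans (ℕₚ.≤-trans (ℕₚ.m≤m+n (suc m) 0) (ℕₚ.m≤n+m _ m)) m+1+m≤n

-- Induction on a bound `b` for one fixed entry: `null-half` yields a vector of the same kind, and
-- halving lowers the bound from `suc b` to at most `b`.
null-vanishes : ∀ {m} (G : Graph (suc m)) b x → IsNull (seidel G) x → x zero ≡ 0ℤ →
                ∀ i → ℤ.∣ x i ∣ ℕ.≤ b → x i ≡ 0ℤ
null-vanishes G zero    x Sx≡0 x₀≡0 i ∣xi∣≤b = ℤₚ.∣i∣≡0⇒i≡0 (ℕₚ.n≤0⇒n≡0 ∣xi∣≤b)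
null-vanishes G (suc b) x Sx≡0 x₀≡0 i ∣xi∣≤b =
  let y , x≡2y , Sy≡0 , y₀≡0 = null-half G x Sx≡0 x₀≡0
      ∣yi∣≤b = 2m≤1+n⇒m≤n (subst (ℕ._≤ suc b)
        (trans (cong ℤ.∣_∣ (x≡2y i)) (ℤₚ.abs-* (+ 2) (y i))) ∣xi∣≤b)
  in trans (x≡2y i) (cong (+ 2 ℤ.*_) (null-vanishes G b y Sy≡0 y₀≡0 i ∣yi∣≤b))

null-proportional : ∀ {m} (G : Graph (suc m)) {x y} →
  IsNull (seidel G) x → IsNull (seidel G) y → x zero ≡ 1ℤ →
  ∀ i → y i ≡ y zero ℤ.* x i
null-proportional G {x} {y} Sx≡0 Sy≡0 x₀≡1 i =
  trans (restore (y i) (y zero) (x i))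
    (trans (cong (ℤ._+ y zero ℤ.* x i) (null-vanishes G ℤ.∣ z i ∣ z Sz≡0 z₀≡0 i ℕₚ.≤-refl))
      (ℤₚ.+-identityˡ _))
  where
  z : Vector ℤ _
  -- The multiple of `x` is chosen to make the first entry 0, so that `null-vanishes` applies.
  z j = y j ℤ.+ (ℤ.- y zero) ℤ.* x j
  restore : ∀ a c b → a ≡ a ℤ.+ (ℤ.- c) ℤ.* b ℤ.+ c ℤ.* b
  restore = solve-∀
  cancel : ∀ c → c ℤ.+ (ℤ.- c) ℤ.* 1ℤ ≡ 0ℤ
  cancel = solve-∀
  z₀≡0 : z zero ≡ 0ℤ
  z₀≡0 = trans (cong (λ t → y zero ℤ.+ (ℤ.- y zero) ℤ.* t) x₀≡1) (cancel (y zero))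
  Sz≡0 : IsNull (seidel G) z
  Sz≡0 k = trans (*ᵥ-distrib-+ (seidel G) y (λ j → (ℤ.- y zero) ℤ.* x j) k)
    (cong₂ ℤ._+_ (Sy≡0 k) (trans (*ᵥ-scale (seidel G) (ℤ.- y zero) x k)
      (trans (cong ((ℤ.- y zero) ℤ.*_) (Sx≡0 k)) (ℤₚ.*-zeroʳ (ℤ.- y zero)))))

-- Normalisation and uniqueness.

foldr-gcd-greatest : ∀ {n} c (x : Vector ℤ n) → (∀ i → c ∣ x i) → c ∣ foldr gcd 0ℤ x
foldr-gcd-greatest {zero}  c x c∣x = ℕ∣._∣0 ℤ.∣ c ∣
foldr-gcd-greatest {suc n} c x c∣x = gcd-greatest {x zero} {foldr gcd 0ℤ (x ∘ suc)} {c}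
  (c∣x zero) (foldr-gcd-greatest c (x ∘ suc) (c∣x ∘ suc))

0<i∧∣i∣≡1⇒i≡1 : ∀ {i} → 0ℤ ℤ.< i → ℤ.∣ i ∣ ≡ 1 → i ≡ 1ℤ
0<i∧∣i∣≡1⇒i≡1 {+ _} _ ∣i∣≡1 = cong +_ ∣i∣≡1

-- A competing vector `y` is `y zero` times `x`; the sign and gcd conditions force this scalar to be
-- 1.
isPhi : ∀ {m} (G : Graph (suc m)) {x} → IsNull (seidel G) x → x zero ≡ 1ℤ →
        IsPhi (seidel G) x
isPhi G {x} Sx≡0 x₀≡1 = record
  { normalisedNullVector = record
    { null                 = Sx≡0
    ; gcd≡1                = trans (cong (λ t → gcd t (foldr gcd 0ℤ (x ∘ suc))) x₀≡1)
                                   (gcd-zeroˡ (foldr gcd 0ℤ (x ∘ suc)))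
    ; firstNonZeroPositive = zero , subst (0ℤ ℤ.<_) (sym x₀≡1) (ℤ.+<+ (ℕ.s≤s ℕ.z≤n)) , λ _ ()
    }
  ; unique = λ y Y i → trans (proportional Y i)
      (trans (cong (ℤ._* x i) (y₀≡1 Y)) (ℤₚ.*-identityˡ (x i)))
  }
  where
  open IsNormalisedNullVector
  proportional : ∀ {y} → IsNormalisedNullVector (seidel G) y → ∀ i → y i ≡ y zero ℤ.* x i
  proportional Y = null-proportional G Sx≡0 (null Y) x₀≡1

  0<y₀ : ∀ {y} → IsNormalisedNullVector (seidel G) y → 0ℤ ℤ.< y zero
  0<y₀ Y with firstNonZeroPositive Y
  ... | zero  , 0<y₀ , _ = 0<y₀
  -- Here `y zero` would be 0, and proportionality would make the positive entry 0 as well.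
  ... | suc i , 0<yᵢ , y≡0 = ⊥-elim (ℤₚ.<-irrefl (sym yᵢ≡0) 0<yᵢ)
    where yᵢ≡0 = trans (proportional Y (suc i))
                   (cong (ℤ._* x (suc i)) (y≡0 zero (ℕ.s≤s ℕ.z≤n)))

  y₀≡1 : ∀ {y} → IsNormalisedNullVector (seidel G) y → y zero ≡ 1ℤ
  -- The scalar `y zero` divides every entry of `y`, hence their gcd 1; positivity then excludes -1.
  y₀≡1 {y} Y = 0<i∧∣i∣≡1⇒i≡1 (0<y₀ Y) (ℕ∣.∣1⇒≡1 (subst (y zero ∣_) (gcd≡1 Y)
    (foldr-gcd-greatest (y zero) y λ i →
      subst (ℤ.∣ y zero ∣ ℕ∣.∣_)
        (sym (trans (cong ℤ.∣_∣ (proportional Y i)) (ℤₚ.abs-* (y zero) (x i))))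
        (ℕ∣.m∣m*n ℤ.∣ x i ∣))))

-- Switching with respect to a vertex set.

SwitchedBy : ∀ {n} → (Fin n → Bool) → Graph n → Graph n → Set
SwitchedBy b G H = ∀ i j → adj H i j ≡ (b i xor b j) xor adj G i j

xor-cancelˡ : ∀ a b → a xor (a xor b) ≡ b
xor-cancelˡ a b = trans (sym (Bool.xor-assoc a a b)) (cong (_xor b) (Bool.xor-same a))

xor-interchange : ∀ a b c d → (a xor b) xor (c xor d) ≡ (a xor c) xor (b xor d)
xor-interchange false b c d = trans (sym (Bool.xor-assoc b c d))
  (trans (cong (_xor d) (Bool.xor-comm b c)) (Bool.xor-assoc c b d))
xor-interchange true  b c d = trans (sym (Bool.not-distribˡ-xor b (c xor d)))
  (trans (cong not (xor-interchange false b c d)) (Bool.not-distribˡ-xor c (b xor d)))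

-- Two switchings at the same vertex cancel, so a sequence acts as the set of vertices occurring in
-- it an odd number of times.
parity : ∀ {n} → List (Fin n) → Fin n → Bool
parity []       i = false
parity (v ∷ vs) i = parity vs i xor does (i ≟ v)

foldl-switch : ∀ {n} (G : Graph n) vs → SwitchedBy (parity vs) G (foldl switch G vs)
foldl-switch G []       i j = refl
foldl-switch G (v ∷ vs) i j = trans (foldl-switch (switch G v) vs i j)
  (trans (sym (Bool.xor-assoc (p i xor p j) (d i xor d j) (adj G i j)))
    (cong (_xor adj G i j) (xor-interchange (p i) (p j) (d i) (d j))))
  where
  p d : Fin _ → Bool
  p = parity vs
  d k = does (k ≟ v)

-- Each vertex of the set occurs once, which makes this a right inverse of `parity`: every vertex
-- set is realised by single switchings.
vertices : ∀ {n} → (Fin n → Bool) → List (Fin n)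
vertices {zero}  b = []
vertices {suc n} b = if b zero then zero ∷ vs else vs
  where vs = map suc (vertices (b ∘ suc))

parity-map-suc-zero : ∀ {n} (vs : List (Fin n)) → parity (map suc vs) zero ≡ false
parity-map-suc-zero []       = refl
parity-map-suc-zero (v ∷ vs) = trans (Bool.xor-identityʳ _) (parity-map-suc-zero vs)

parity-map-suc-suc : ∀ {n} (vs : List (Fin n)) i → parity (map suc vs) (suc i) ≡ parity vs i
parity-map-suc-suc []       i = refl
parity-map-suc-suc (v ∷ vs) i = cong (_xor does (i ≟ v)) (parity-map-suc-suc vs i)

parity-vertices : ∀ {n} (b : Fin n → Bool) → parity (vertices b) ≗ b
parity-vertices {suc n} b zero with b zero
... | true  = cong (_xor true) (parity-map-suc-zero (vertices (b ∘ suc)))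
... | false = parity-map-suc-zero (vertices (b ∘ suc))
parity-vertices {suc n} b (suc i) with b zero
... | true  = trans (Bool.xor-identityʳ _)
  (trans (parity-map-suc-suc (vertices (b ∘ suc)) i) (parity-vertices (b ∘ suc) i))
... | false = trans (parity-map-suc-suc (vertices (b ∘ suc)) i) (parity-vertices (b ∘ suc) i)

-- Sign vectors and conjugation of the Seidel matrix.

sign : Bool → ℤ
sign b = if b then -1ℤ else 1ℤ

signVector⇒sign : ∀ {n} {x : Vector ℤ n} → SignVector x → ∃ λ b → ∀ i → x i ≡ sign (b i)
signVector⇒sign {x = x} ±1 = (λ i → proj₁ (bit (±1 i))) , (λ i → proj₂ (bit (±1 i)))
  where
  bit : ∀ {y} → y ≡ 1ℤ ⊎ y ≡ -1ℤ → ∃ λ b → y ≡ sign b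
  bit (inj₁ y≡1)  = false , y≡1
  bit (inj₂ y≡-1) = true  , y≡-1

sign-isSign : ∀ b → sign b ≡ 1ℤ ⊎ sign b ≡ -1ℤ
sign-isSign false = inj₁ refl
sign-isSign true  = inj₂ refl

sign-involutive : ∀ b → sign b ℤ.* sign b ≡ 1ℤ
sign-involutive false = refl
sign-involutive true  = refl

-- Off the diagonal an entry is 1 or -1, and toggling the adjacency negates it; this happens exactly
-- when the two signs differ. Diagonal entries are 0.
seidel-switched : ∀ {n} b (G H : Graph n) → SwitchedBy b G H →
  ∀ i j → seidel H i j ≡ sign (b i) ℤ.* seidel G i j ℤ.* sign (b j)
seidel-switched b G H switched i j = go (i ≟ j)
  where
  entry : Bool → Bool → ℤ
  entry d a = 1ℤ ℤ.- (if d then 1ℤ else 0ℤ) ℤ.- + 2 ℤ.* (if a then 1ℤ else 0ℤ)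

  loop : ∀ s → entry true false ≡ sign s ℤ.* entry true false ℤ.* sign s
  loop false = refl
  loop true  = refl

  nonLoop : ∀ s t a → entry false ((s xor t) xor a) ≡ sign s ℤ.* entry false a ℤ.* sign t
  nonLoop false false false = refl
  nonLoop false false true  = refl
  nonLoop false true  false = refl
  nonLoop false true  true  = refl
  nonLoop true  false false = refl
  nonLoop true  false true  = refl
  nonLoop true  true  false = refl
  nonLoop true  true  true  = refl

  -- Abstracting the decision reduces the claim to finite tables of Booleans.
  go : (d : Dec (i ≡ j)) → entry (does d) (adj H i j) ≡
       sign (b i) ℤ.* entry (does d) (adj G i j) ℤ.* sign (b j)
  go (yes refl) rewrite no-loop G i | no-loop H i = loop (b i)
  go (no _)     rewrite switched i j = nonLoop (b i) (b j) (adj G i j)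

-- The diagonal sign matrix D is its own inverse, so (D S D)(D `x`) = D (S `x`) = 0.
null-switched : ∀ {n} b (G H : Graph n) x → SwitchedBy b G H →
  IsNull (seidel G) x → IsNull (seidel H) (λ i → sign (b i) ℤ.* x i)
null-switched b G H x switched Sx≡0 i = begin
  (seidel H *ᵥ (λ j → sign (b j) ℤ.* x j)) i
    ≡⟨ sum-cong-≗ entry ⟩
  sum (λ j → sign (b i) ℤ.* (seidel G i j ℤ.* x j))
    ≡⟨ *-distribˡ-sum (sign (b i)) (λ j → seidel G i j ℤ.* x j) ⟨
  sign (b i) ℤ.* (seidel G *ᵥ x) i
    ≡⟨ cong (sign (b i) ℤ.*_) (Sx≡0 i) ⟩
  sign (b i) ℤ.* 0ℤ
    ≡⟨ ℤₚ.*-zeroʳ (sign (b i)) ⟩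
  0ℤ ∎
  where
  open ≡-Reasoning
  regroup : ∀ s m t x → s ℤ.* m ℤ.* t ℤ.* (t ℤ.* x) ≡ t ℤ.* t ℤ.* (s ℤ.* (m ℤ.* x))
  regroup = solve-∀
  entry : ∀ j → seidel H i j ℤ.* (sign (b j) ℤ.* x j) ≡ sign (b i) ℤ.* (seidel G i j ℤ.* x j)
  entry j = begin
    seidel H i j ℤ.* (sign (b j) ℤ.* x j)
      ≡⟨ cong (ℤ._* (sign (b j) ℤ.* x j)) (seidel-switched b G H switched i j) ⟩
    sign (b i) ℤ.* seidel G i j ℤ.* sign (b j) ℤ.* (sign (b j) ℤ.* x j)
      ≡⟨ regroup (sign (b i)) (seidel G i j) (sign (b j)) (x j) ⟩
    sign (b j) ℤ.* sign (b j) ℤ.* (sign (b i) ℤ.* (seidel G i j ℤ.* x j))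
      ≡⟨ cong (ℤ._* (sign (b i) ℤ.* (seidel G i j ℤ.* x j))) (sign-involutive (b j)) ⟩
    1ℤ ℤ.* (sign (b i) ℤ.* (seidel G i j ℤ.* x j))
      ≡⟨ ℤₚ.*-identityˡ _ ⟩
    sign (b i) ℤ.* (seidel G i j ℤ.* x j) ∎

IsNull-cong : ∀ {n} (M : Matrix ℤ n) {x y} → x ≗ y → IsNull M x → IsNull M y
IsNull-cong M x≗y Mx≡0 i =
  trans (sym (sum-cong-≗ λ j → cong (M i j ℤ.*_) (x≗y j))) (Mx≡0 i)

-- The all-ones vector and regularity.

ones : ∀ {n} → Vector ℤ n
ones i = 1ℤ

sum-ones : ∀ n → sum (ones {n}) ≡ + n
sum-ones zero    = refl
sum-ones (suc n) = cong (ℤ._+_ 1ℤ) (sum-ones n)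

-- The factor `1ℤ` is an entry of `ones`: for `b` = `adj G i` the sum is row `i` of
-- `adjacency G *ᵥ ones`.
sum-indicator : ∀ {n} (b : Fin n → Bool) →
  sum (λ i → (if b i then 1ℤ else 0ℤ) ℤ.* 1ℤ) ≡ + ∣ tabulate b ∣
sum-indicator {zero}  b = refl
sum-indicator {suc n} b with b zero
... | true  = cong (ℤ._+_ 1ℤ) (sum-indicator (b ∘ suc))
... | false = trans (ℤₚ.+-identityˡ _) (sum-indicator (b ∘ suc))

seidel-row-ones : ∀ {m} (G : Graph (suc m)) i →
  (seidel G *ᵥ ones) i ℤ.+ + (2 * degree G i) ≡ + m
-- Adding 1, the entry of `ones` at `i`, recovers `seidel-row`, whose right-hand side is the order
-- `suc m`.
seidel-row-ones {m} G i = ∙-cancelˡ 1ℤ _ _ (begin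
  1ℤ ℤ.+ (Sᵢ ℤ.+ + (2 * degree G i))
    ≡⟨ cong (λ t → 1ℤ ℤ.+ (Sᵢ ℤ.+ t)) (ℤₚ.pos-* 2 (degree G i)) ⟩
  1ℤ ℤ.+ (Sᵢ ℤ.+ + 2 ℤ.* + degree G i)
    ≡⟨ cong (λ t → 1ℤ ℤ.+ (Sᵢ ℤ.+ + 2 ℤ.* t)) (sum-indicator (adj G i)) ⟨
  1ℤ ℤ.+ (Sᵢ ℤ.+ + 2 ℤ.* (adjacency G *ᵥ ones) i)
    ≡⟨ swap 1ℤ Sᵢ _ ⟩
  Sᵢ ℤ.+ (1ℤ ℤ.+ + 2 ℤ.* (adjacency G *ᵥ ones) i)
    ≡⟨ seidel-row G ones i ⟩
  sum (ones {suc m})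
    ≡⟨ sum-ones (suc m) ⟩
  + suc m ∎)
  where
  open ≡-Reasoning
  Sᵢ = (seidel G *ᵥ ones) i
  swap : ∀ a b c → a ℤ.+ (b ℤ.+ c) ≡ b ℤ.+ (a ℤ.+ c)
  swap = solve-∀

null-ones⇒regular : ∀ {d} (G : Graph (suc (2 * d))) → IsNull (seidel G) ones → Regular d G
null-ones⇒regular {d} G S1≡0 i = ℕₚ.*-cancelˡ-≡ (degree G i) d 2 (ℤₚ.+-injective
  (trans (sym (ℤₚ.+-identityˡ _))
    (trans (cong (ℤ._+ + (2 * degree G i)) (sym (S1≡0 i))) (seidel-row-ones G i))))

regular⇒null-ones : ∀ {d} (G : Graph (suc (2 * d))) → Regular d G → IsNull (seidel G) ones
regular⇒null-ones {d} G reg i = ∙-cancelʳ (+ (2 * d)) _ _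
  (trans (cong (λ t → (seidel G *ᵥ ones) i ℤ.+ + (2 * t)) (sym (reg i)))
    (seidel-row-ones G i))

-- Null sign vectors versus switching to a regular graph.

signNull⇒switchedRegular : ∀ {d} (G : Graph (suc (2 * d))) {x} →
  IsNull (seidel G) x → SignVector x →
  ∃ λ H → Regular d H × SwitchingEquivalent H G
signNull⇒switchedRegular G {x} Sx≡0 ±1 with signVector⇒sign ±1
... | b , x≡sign = H , null-ones⇒regular H S1≡0 , vs , H~G
  where
  vs = vertices b
  H  = foldl switch G vs
  S1≡0 : IsNull (seidel H) ones
  S1≡0 = IsNull-cong (seidel H)
    -- The switching set is where `x` is -1, so each entry of `x` is multiplied by itself and
    -- becomes 1.
    (λ i → trans (cong₂ ℤ._*_ (cong sign (parity-vertices b i)) (x≡sign i)) (sign-involutive (b i)))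
    (null-switched (parity vs) G H x (foldl-switch G vs) Sx≡0)
  H~G : foldl switch H vs ≐ G
  -- Running the same list again undoes the switching, since equal toggles cancel.
  H~G i j = trans (foldl-switch H vs i j)
    (trans (cong ((parity vs i xor parity vs j) xor_) (foldl-switch G vs i j))
      (xor-cancelˡ (parity vs i xor parity vs j) (adj G i j)))

switchedRegular⇒signNull : ∀ {d} (G H : Graph (suc (2 * d))) →
  Regular d H → SwitchingEquivalent H G →
  ∃ λ x → IsNull (seidel G) x × SignVector x × x zero ≡ 1ℤ
switchedRegular⇒signNull G H reg (vs , H~G) =
  (λ i → sign (c i)) ,
  IsNull-cong (seidel G) (λ i → ℤₚ.*-identityʳ (sign (c i)))
    (null-switched c H G ones switched (regular⇒null-ones H reg)) ,
  (λ i → sign-isSign (c i)) ,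
  cong sign (Bool.xor-same (b zero))
  where
  b c : Fin _ → Bool
  b = parity vs
  -- Complementing b if necessary makes the first entry of the null vector positive.
  c i = b zero xor b i
  switched : SwitchedBy c H G
  -- The constant `b zero` cancels in `c i xor c j`: a set and its complement switch alike.
  switched i j = trans (sym (H~G i j)) (trans (foldl-switch H vs i j)
    (cong (_xor adj H i j) (sym (trans (xor-interchange (b zero) (b i) (b zero) (b j))
      (cong (_xor (b i xor b j)) (Bool.xor-same (b zero)))))))

theorem5p1 : (k n : ℕ) → n ≡ 4 * k + 1 → (G : Graph n) →
    (Singular (seidel G) × (∃ λ (φ : Vector ℤ n) → IsPhi (seidel G) φ × SignVector φ))
    ⇔ (∃ λ (H : Graph n) → Regular (2 * k) H × SwitchingEquivalent H G)
theorem5p1 k n n≡4k+1 G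
  -- The order is rewritten as `suc (2 * (2 * k))`, the form `suc (2 * d)` with `d` = `2 * k`.
  with trans n≡4k+1 (trans (ℕₚ.+-comm (4 * k) 1) (cong suc (ℕₚ.*-assoc 2 2 k)))
... | refl = mk⇔
  (λ (_ , φ , isφ , ±1) → signNull⇒switchedRegular G
    (IsNormalisedNullVector.null (IsPhi.normalisedNullVector isφ)) ±1)
  λ (H , reg , H~G) →
    let x , Sx≡0 , ±1 , x₀≡1 = switchedRegular⇒signNull G H reg H~G
    in nullVector⇒singular {M = seidel G} x Sx≡0 zero x₀≡1 , x , isPhi G Sx≡0 x₀≡1 , ±1
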